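{- Let $(U,\oplus,\odot,\underline{0},\underline{1},\geq,>,\mathsf{mono},\mathsf{max}_0)$ be an ordered semiring with max. Let $\mathcal{F}$ be a signature and $\mathcal{V}$ a set of variables, and let $\mathcal{P}ol$ be a polynomial interpretation assigning to every $n$-ary symbol $f\in\mathcal{F}$ a linear polynomial $[f](x_1,\dots,x_n)=f_0\oplus f_1\odot x_1\oplus\cdots\oplus f_n\odot x_n$ with $f_0,\dots,f_n\in U$ such that $f_i\geq\underline{0}$ for all $1\leq i\leq n$ (no condition is imposed on $f_0$). Let $\succsim_{\mathcal{P}ol}$ and $\succ_{\mathcal{P}ol}$ be the relations on terms over $\mathcal{F}$ and $\mathcal{V}$ induced by the interpretation in which each $f$ is interpreted by $\mathsf{max}_0([f](x_1,\dots,x_n))$ (see context). Then $(\succsim_{\mathcal{P}ol},\succ_{\mathcal{P}ol})$ is a reduction pair, where $s\succ_{\mathcal{P}ol}t$ can be approximated by $[s]_{\mathit{left}}>[t]_{\mathit{right}}$ and $s\succsim_{\mathcal{P}ol}t$ can be approximated by $[s]_{\mathit{left}}\geq[t]_{\mathit{right}}$; that is, for all terms $s,t$: if $[s]_{\mathit{left}}>[t]_{\mathit{right}}$ then $s\succ_{\mathcal{P}ol}t$, and if $[s]_{\mathit{left}}\geq[t]_{\mathit{right}}$ then $s\succsim_{\mathcal{P}ol}t$.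
   Context: Semiring with one-element: a structure $(U,\oplus,\odot,\underline{0},\underline{1})$ with binary operations $\oplus,\odot$ on $U$ and $\underline{0},\underline{1}\in U$ such that $\oplus$ and $\odot$ are associative, $\oplus$ is commutative, $\underline{0}\neq\underline{1}$, $\underline{0}$ is neutral for $\oplus$, $\underline{1}$ is neutral for $\odot$, $\underline{0}\odot x=x\odot\underline{0}=\underline{0}$, and $\odot$ distributes over $\oplus$ on both sides. ($\odot$ need not be commutative.) Ordered semiring: a structure $(U,\oplus,\odot,\underline{0},\underline{1},\geq,>,\mathsf{mono})$, with $\geq$ (a non-strict order) and $>$ (a strict order) binary relations and $\mathsf{mono}$ a unary predicate on $U$, such that $(U,\oplus,\odot,\underline{0},\underline{1})$ is a semiring with one-element and - $\geq$ is reflexive and transitive; $>$ is transitive; ${>}\circ{\geq}\subseteq{>}$ and ${\geq}\circ{>}\subseteq{>}$ (i.e. $x>y\geq z$ implies $x>z$, and $x\geq y>z$ implies $x>z$); - $\underline{1}\geq\underline{0}$ and $\mathsf{mono}(\underline{1})$; - if $x\geq y$ then $x\oplus z\geq y\oplus z$; if $x>y$ then $x\oplus z>y\oplus z$; - if $x\geq y$ and $z\geq\underline{0}$ then $x\odot z\geq y\odot z$ and $z\odot x\geq z\odot y$; - if $\mathsf{mono}(x)$, $x\geq\underline{0}$ and $y>z$ then $x\odot y>x\odot z$; - $\{(x,y)\mid x>y\wedge y\geq\underline{0}\}$ is well-founded, i.e. there is no infinite sequence $x_1>x_2>x_3>\cdots$ with $x_i\geq\underline{0}$ for all $i\geq2$.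 Ordered semiring with max: an ordered semiring together with a unary operation $\mathsf{max}_0:U\to U$ such that for all $x,y\in U$: $\mathsf{max}_0(x)\geq\underline{0}$ and $\mathsf{max}_0(x)\geq x$; and $y\geq x\geq\underline{0}$ implies $\mathsf{max}_0(y)\geq\mathsf{max}_0(x)=x$. Induced relations: an assignment is a map $\alpha:\mathcal{V}\to\{u\in U\mid u\geq\underline{0}\}$. The value of a term is $[x]_\alpha=\alpha(x)$ for variables $x$ and $[f(t_1,\dots,t_n)]_\alpha=\mathsf{max}_0(f_0\oplus f_1\odot[t_1]_\alpha\oplus\cdots\oplus f_n\odot[t_n]_\alpha)$. Define $s\succ_{\mathcal{P}ol}t$ iff $[s]_\alpha>[t]_\alpha$ for all assignments $\alpha$, and $s\succsim_{\mathcal{P}ol}t$ iff $[s]_\alpha\geq[t]_\alpha$ for all assignments $\alpha$. Approximations: $[t]_{\mathit{left}}$ and $[t]_{\mathit{right}}$ are formal linear polynomials $c\oplus\bigoplus_{x}a_x\odot x$ over variables $x\in\mathcal{V}$ (finitely many $a_x\ne\underline 0$). Let $\mathsf{cp}(p)=c$ denote the constant part and $\mathsf{ncp}(p)=\bigoplus_x a_x\odot x$ the non-constant part of such a polynomial $p$; $\mathsf{ncp}(p)=\underline{0}$ means all $a_x=\underline{0}$. For variables, $[x]_{\mathit{left}}=[x]_{\mathit{right}}=x$. For $t=f(t_1,\dots,t_n)$ put $p_{\mathit{left}}=[f]([t_1]_{\mathit{left}},\dots,[t_n]_{\mathit{left}})$ and $p_{\mathit{right}}=[f]([t_1]_{\mathit{right}},\dots,[t_n]_{\mathit{right}})$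 (with $[f]$ the linear polynomial, without $\mathsf{max}_0$, expanded by distributivity), and define $[t]_{\mathit{left}}=\mathsf{max}_0(\mathsf{cp}(p_{\mathit{left}}))$ if $\mathsf{ncp}(p_{\mathit{left}})=\underline{0}$ and $[t]_{\mathit{left}}=p_{\mathit{left}}$ otherwise; $[t]_{\mathit{right}}=\mathsf{ncp}(p_{\mathit{right}})\oplus\mathsf{max}_0(\mathsf{cp}(p_{\mathit{right}}))$. For such polynomials $p,q$, $p>q$ (resp. $p\geq q$) means that the value of $p$ is $>$ (resp. $\geq$) the value of $q$ under every assignment $\alpha$. Reduction pair: a pair $(\succsim,\succ)$ of partial orders on terms (understood as transitive relations; antisymmetry of $\succsim$ is not required) such that $\succsim$ and $\succ$ are stable (closed under substitutions), $\succsim$ is reflexive and monotone (closed under contexts), $\succ$ is well-founded (no infinite sequence $t_1\succ t_2\succ\cdots$), and ${\succsim}\circ{\succ}\subseteq{\succ}$.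
   Formalization: max₀ is assumed monotone on all of U (y ≥ x implies max₀(y) ≥ max₀(x)), not only for x ≥ 0; otherwise ≿ need not be monotone (over ℤ: max₀(-1)=5, [g](x)=-2+x). The approximation part assumes equality of variables and equality to 0 in U decidable, as holds classically. -}

module Defs where

open import Algebra.Bundles using (Semiring)
import Algebra.Definitions.RawMonoid as RawMonoidDefinitions
open import Data.Bool.Base using (if_then_else_)
open import Data.Empty using (⊥-elim)
open import Data.Fin.Base using (Fin)
open import Data.List.Base as List using (List; []; _∷_)
open import Data.List.Membership.DecPropositional using () renaming (_∈?_ to member?)
open import Data.List.Membership.Propositional using (_∈_; _∉_)
open import Data.List.Relation.Unary.All as All using (All)
open import Data.List.Relation.Unary.Any using (here; there)
open import Data.Nat.Base using (ℕ)
open import Data.Product using (_×_; _,_; proj₁; proj₂; ∃-syntax)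
open import Data.Vec.Functional using (Vector; updateAt)
open import Function.Base using (const)
open import Induction.InfiniteDescent using (InfiniteDescendingSequence)
open import Level using (Level; _⊔_) renaming (suc to lsuc)
open import Relation.Binary.Core using (Rel)
open import Relation.Binary.Definitions using (DecidableEquality; Reflexive; Transitive; _Respects_)
open import Relation.Binary.PropositionalEquality using (sym)
open import Relation.Binary.Structures using (IsPreorder)
open import Relation.Nullary using (Dec; yes; no; does; ¬_)
open import Relation.Nullary.Decidable using (map′)
open import Relation.Unary using (Pred)

-- Classically this is equivalent to accessibility of every element (the
-- library's WellFounded for the converse relation); constructively it is weaker.
Terminating : ∀ {a r} {A : Set a} → Rel A r → Set (a ⊔ r)
Terminating _>_ = ¬ (∃[ xs ] InfiniteDescendingSequence (λ y x → x > y) xs)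

record OrderedSemiring (c ℓ ℓ₁ ℓ₂ ℓ₃ : Level) : Set (lsuc (c ⊔ ℓ ⊔ ℓ₁ ⊔ ℓ₂ ⊔ ℓ₃)) where
  infix 4 _≥_ _>_
  field
    semiring : Semiring c ℓ

  open Semiring semiring public
    renaming ( Carrier to U; _+_ to _⊕_; _*_ to _⊙_
             ; refl to ≈-refl; sym to ≈-sym; trans to ≈-trans; reflexive to ≈-reflexive )

  field
    _≥_  : Rel U ℓ₁
    _>_  : Rel U ℓ₂
    mono : Pred U ℓ₃

    0≉1          : ¬ (0# ≈ 1#)
    ≥-isPreorder : IsPreorder _≈_ _≥_
    >-trans      : Transitive _>_
    >-≥-trans    : ∀ {x y z} → x > y → y ≥ z → x > z
    ≥->-trans    : ∀ {x y z} → x ≥ y → y > z → x > z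
    mono-resp-≈  : mono Respects _≈_

    1≥0    : 1# ≥ 0#
    mono-1 : mono 1#

    ⊕-monoˡ-≥ : ∀ {x y} z → x ≥ y → x ⊕ z ≥ y ⊕ z
    ⊕-monoˡ-> : ∀ {x y} z → x > y → x ⊕ z > y ⊕ z
    ⊙-monoˡ-≥ : ∀ {x y z} → x ≥ y → z ≥ 0# → x ⊙ z ≥ y ⊙ z
    ⊙-monoʳ-≥ : ∀ {x y z} → x ≥ y → z ≥ 0# → z ⊙ x ≥ z ⊙ y
    ⊙-monoʳ-> : ∀ {x y z} → mono x → x ≥ 0# → y > z → x ⊙ y > x ⊙ z

    >-terminating : Terminating (λ x y → x > y × y ≥ 0#)

record OrderedSemiringWithMax (c ℓ ℓ₁ ℓ₂ ℓ₃ : Level) : Set (lsuc (c ⊔ ℓ ⊔ ℓ₁ ⊔ ℓ₂ ⊔ ℓ₃)) where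
  field
    orderedSemiring : OrderedSemiring c ℓ ℓ₁ ℓ₂ ℓ₃

  open OrderedSemiring orderedSemiring public

  field
    max₀      : U → U
    max₀-cong : ∀ {x y} → x ≈ y → max₀ x ≈ max₀ y
    max₀≥0    : ∀ x → max₀ x ≥ 0#
    max₀≥     : ∀ x → max₀ x ≥ x

    -- The axiom "y ≥ x ≥ 0 implies max₀ y ≥ max₀ x = x", read link by link:
    -- y ≥ x gives max₀ y ≥ max₀ x, and x ≥ 0 gives max₀ x = x.  Were
    -- monotonicity required only for x ≥ 0, it would already follow from
    -- max₀-id, and max₀ could take arbitrary non-negative values on negative
    -- arguments (over ℤ: max₀ (-1) = 5), so that x ↦ max₀ (-2 ⊕ x) would not
    -- be monotone.
    max₀-mono : ∀ {x y} → y ≥ x → max₀ y ≥ max₀ x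
    max₀-id   : ∀ {x} → x ≥ 0# → max₀ x ≈ x

record Signature (f : Level) : Set (lsuc f) where
  field
    Symbol : Set f
    arity  : Symbol → ℕ

module Terms {f v} (𝓕 : Signature f) (𝒱 : Set v) where
  open Signature 𝓕

  data Term : Set (f ⊔ v) where
    var : 𝒱 → Term
    app : (g : Symbol) → Vector Term (arity g) → Term

  Substitution : Set (f ⊔ v)
  Substitution = 𝒱 → Term

  infixl 8 _·_
  _·_ : Term → Substitution → Term
  var x    · σ = σ x
  app g ts · σ = app g (λ i → ts i · σ)

  -- In inside g ts i C the hole lies in argument i; the entry ts i is discarded.
  data Context : Set (f ⊔ v) where
    □      : Context
    inside : (g : Symbol) → Vector Term (arity g) → Fin (arity g) → Context → Context

  infixl 8 _⟨_⟩
  _⟨_⟩ : Context → Term → Term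
  □               ⟨ t ⟩ = t
  inside g ts i C ⟨ t ⟩ = app g (updateAt ts i (const (C ⟨ t ⟩)))

  Stable : ∀ {r} → Rel Term r → Set (f ⊔ v ⊔ r)
  Stable _R_ = ∀ {s t} (σ : Substitution) → s R t → (s · σ) R (t · σ)

  Monotone : ∀ {r} → Rel Term r → Set (f ⊔ v ⊔ r)
  Monotone _R_ = ∀ {s t} (C : Context) → s R t → (C ⟨ s ⟩) R (C ⟨ t ⟩)

  -- "Partial order" only means transitive here; the reflexivity of ≿ is listed
  -- separately and antisymmetry is not required.
  record IsReductionPair {r₁ r₂} (_≿_ : Rel Term r₁) (_≻_ : Rel Term r₂) : Set (f ⊔ v ⊔ r₁ ⊔ r₂) where
    field
      ≿-trans       : Transitive _≿_
      ≻-trans       : Transitive _≻_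
      ≿-stable      : Stable _≿_
      ≻-stable      : Stable _≻_
      ≿-refl        : Reflexive _≿_
      ≿-monotone    : Monotone _≿_
      ≻-terminating : Terminating _≻_
      ≿-≻-trans     : ∀ {s t u} → s ≿ t → t ≻ u → s ≻ u

module _ {c ℓ ℓ₁ ℓ₂ ℓ₃ f} (R : OrderedSemiringWithMax c ℓ ℓ₁ ℓ₂ ℓ₃) (𝓕 : Signature f) where
  open OrderedSemiringWithMax R
  open Signature 𝓕

  record LinearInterpretation : Set (c ⊔ ℓ₁ ⊔ f) where
    field
      constant      : Symbol → U
      coefficient   : (g : Symbol) → Vector U (arity g)
      coefficient≥0 : ∀ g i → coefficient g i ≥ 0#

module PolynomialOrder
  {c ℓ ℓ₁ ℓ₂ ℓ₃ f v} (R : OrderedSemiringWithMax c ℓ ℓ₁ ℓ₂ ℓ₃) (𝓕 : Signature f) (𝒱 : Set v)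
  (Pol : LinearInterpretation R 𝓕) where

  open OrderedSemiringWithMax R
  open Signature 𝓕
  open Terms 𝓕 𝒱 public
  open LinearInterpretation Pol
  open RawMonoidDefinitions +-rawMonoid using (sum)

  Assignment : Set (c ⊔ ℓ₁ ⊔ v)
  Assignment = 𝒱 → ∃[ u ] u ≥ 0#

  ⟦_⟧ : Term → Assignment → U
  ⟦ var x    ⟧ α = proj₁ (α x)
  ⟦ app g ts ⟧ α = max₀ (constant g ⊕ sum (λ i → coefficient g i ⊙ ⟦ ts i ⟧ α))

  infix 4 _≻_ _≿_
  _≻_ : Rel Term (c ⊔ ℓ₁ ⊔ ℓ₂ ⊔ v)
  s ≻ t = ∀ α → ⟦ s ⟧ α > ⟦ t ⟧ α

  _≿_ : Rel Term (c ⊔ ℓ₁ ⊔ v)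
  s ≿ t = ∀ α → ⟦ s ⟧ α ≥ ⟦ t ⟧ α

  -- A formal linear polynomial: a constant part and a list of monomials a ⊙ x.
  -- A variable may occur in several monomials; its coefficient is their sum
  -- (see coeff below).
  record Polynomial : Set (c ⊔ v) where
    constructor _⊞_
    field
      cp  : U
      ncp : List (U × 𝒱)

  open Polynomial public

  eval : Polynomial → Assignment → U
  eval p α = cp p ⊕ List.foldr (λ (a , x) r → a ⊙ proj₁ (α x) ⊕ r) 0# (ncp p)

  infix 4 _>ᴾ_ _≥ᴾ_
  _>ᴾ_ : Rel Polynomial (c ⊔ ℓ₁ ⊔ ℓ₂ ⊔ v)
  p >ᴾ q = ∀ α → eval p α > eval q α

  _≥ᴾ_ : Rel Polynomial (c ⊔ ℓ₁ ⊔ v)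
  p ≥ᴾ q = ∀ α → eval p α ≥ eval q α

  varᴾ : 𝒱 → Polynomial
  varᴾ x = 0# ⊞ ((1# , x) ∷ [])

  -- [g](p₁,…,pₙ), expanded by distributivity and without max₀.
  substᴾ : (g : Symbol) → Vector Polynomial (arity g) → Polynomial
  substᴾ g ps =
    (constant g ⊕ sum (λ i → coefficient g i ⊙ cp (ps i))) ⊞
    List.concat (List.tabulate λ i → List.map (λ (a , x) → coefficient g i ⊙ a , x) (ncp (ps i)))

  [_]right : Term → Polynomial
  [ var x    ]right = varᴾ x
  [ app g ts ]right = max₀ (cp p) ⊞ ncp p
    where p = substᴾ g (λ i → [ ts i ]right)

  -- [ t ]left distinguishes ncp p = 0 from ncp p ≠ 0, which needs equality of
  -- variables and equality to 0# in U to be decidable.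
  module Left (_≟_ : DecidableEquality 𝒱) (_≈0? : ∀ u → Dec (u ≈ 0#)) where

    coeffOf : List (U × 𝒱) → 𝒱 → U
    coeffOf []             y = 0#
    coeffOf ((a , x) ∷ ms) y = if does (x ≟ y) then a ⊕ coeffOf ms y else coeffOf ms y

    coeff : Polynomial → 𝒱 → U
    coeff p = coeffOf (ncp p)

    NcpZero : Polynomial → Set (ℓ ⊔ v)
    NcpZero p = ∀ x → coeff p x ≈ 0#

    private
      coeffOf-∉ : ∀ ms {y} → y ∉ List.map proj₂ ms → coeffOf ms y ≈ 0#
      coeffOf-∉ []             y∉ = ≈-refl
      coeffOf-∉ ((a , x) ∷ ms) {y} y∉ with x ≟ y
      ... | yes x≡y = ⊥-elim (y∉ (here (sym x≡y)))
      ... | no  _   = coeffOf-∉ ms (λ y∈ → y∉ (there y∈))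

    ncpZero? : ∀ p → Dec (NcpZero p)
    ncpZero? p = map′ extend (λ z → All.tabulate (λ {x} _ → z x))
                      (All.all? (λ x → coeff p x ≈0?) (List.map proj₂ (ncp p)))
      where
      extend : All (λ x → coeff p x ≈ 0#) (List.map proj₂ (ncp p)) → NcpZero p
      extend zs y with member? _≟_ y (List.map proj₂ (ncp p))
      ... | yes y∈ = All.lookup zs y∈
      ... | no  y∉ = coeffOf-∉ (ncp p) y∉

    [_]left : Term → Polynomial
    [ var x    ]left = varᴾ x
    [ app g ts ]left = if does (ncpZero? p) then max₀ (cp p) ⊞ [] else p
      where p = substᴾ g (λ i → [ ts i ]left)

{-# OPTIONS --safe #-}

-- By induction on t, eval [ t ]left α ≤ ⟦ t ⟧ α ≤ eval [ t ]right α, which gives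
-- both approximations.  On the left, if the non-constant part is formally zero,
-- then it also evaluates to zero (setting one variable after the other to 0 does
-- not change its value), and max₀ is monotone.  On the right, the non-constant
-- part N has a value ≥ 0, so that max₀ (c ⊕ N) ≤ max₀ (max₀ c ⊕ N) = max₀ c ⊕ N.
-- An infinite ≻-descent, evaluated under the assignment 0, would be an infinite
-- descent of non-negative values.
module Submission where

open import Defs
import Algebra.Properties.Semiring.Sum as SemiringSum
open import Data.Bool.Base using (if_then_else_)
open import Data.Empty using (⊥-elim)
open import Data.Fin.Base using (zero; suc)
open import Data.Fin.Properties using () renaming (_≟_ to _≟ᶠ_)
open import Data.List.Base as List using (List; []; _∷_; _++_)
open import Data.List.Membership.Propositional using (_∈_)
open import Data.List.Relation.Unary.Any using (here; there)
open import Data.Nat.Base using (zero; suc)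
open import Data.Product using (_×_; _,_; proj₁; proj₂)
open import Data.Vec.Functional using (Vector; updateAt)
open import Data.Vec.Functional.Properties using (updateAt-updates; updateAt-minimal)
open import Function.Base using (const; _∘_)
open import Relation.Binary.Bundles using (Preorder)
open import Relation.Binary.Definitions using (DecidableEquality)
open import Relation.Binary.PropositionalEquality using (refl; subst₂; sym)
import Relation.Binary.Reasoning.Preorder as PreorderReasoning
import Relation.Binary.Reasoning.Setoid as SetoidReasoning
open import Relation.Binary.Structures using (IsPreorder)
open import Relation.Nullary using (Dec; yes; no; does)

-- Compatibility of the order with sums and products.

module OrderedSemiringProperties {c ℓ ℓ₁ ℓ₂ ℓ₃} (R : OrderedSemiring c ℓ ℓ₁ ℓ₂ ℓ₃) where
  open OrderedSemiring R hiding (zero)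
  open SemiringSum semiring using (sum)

  ≥-preorder : Preorder c ℓ ℓ₁
  ≥-preorder = record { isPreorder = ≥-isPreorder }

  open IsPreorder ≥-isPreorder public
    using () renaming (refl to ≥-refl; reflexive to ≥-reflexive; trans to ≥-trans)

  ⊕-monoʳ-≥ : ∀ {x y} z → x ≥ y → z ⊕ x ≥ z ⊕ y
  ⊕-monoʳ-≥ {x} {y} z x≥y =
    ≥-trans (≥-reflexive (+-comm z x)) (≥-trans (⊕-monoˡ-≥ z x≥y) (≥-reflexive (+-comm y z)))

  ⊕-mono-≥ : ∀ {x y z w} → x ≥ y → z ≥ w → x ⊕ z ≥ y ⊕ w
  ⊕-mono-≥ {y = y} {z} x≥y z≥w = ≥-trans (⊕-monoˡ-≥ z x≥y) (⊕-monoʳ-≥ y z≥w)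

  ⊕-nonneg : ∀ {x y} → x ≥ 0# → y ≥ 0# → x ⊕ y ≥ 0#
  ⊕-nonneg x≥0 y≥0 = ≥-trans (⊕-mono-≥ x≥0 y≥0) (≥-reflexive (+-identityˡ 0#))

  ⊙-nonneg : ∀ {x y} → x ≥ 0# → y ≥ 0# → x ⊙ y ≥ 0#
  ⊙-nonneg {x} x≥0 y≥0 = ≥-trans (⊙-monoʳ-≥ y≥0 x≥0) (≥-reflexive (zeroʳ x))

  sum-mono-≥ : ∀ {n} {u w : Vector U n} → (∀ i → u i ≥ w i) → sum u ≥ sum w
  sum-mono-≥ {zero}  u≥w = ≥-refl
  sum-mono-≥ {suc n} u≥w = ⊕-mono-≥ (u≥w zero) (sum-mono-≥ (u≥w ∘ suc))

  sum-nonneg : ∀ {n} {u : Vector U n} → (∀ i → u i ≥ 0#) → sum u ≥ 0#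
  sum-nonneg {zero}  u≥0 = ≥-refl
  sum-nonneg {suc n} u≥0 = ⊕-nonneg (u≥0 zero) (sum-nonneg (u≥0 ∘ suc))

-- Values of formal linear forms.

module LinearForms {c ℓ ℓ₁ ℓ₂ ℓ₃ v} (R : OrderedSemiring c ℓ ℓ₁ ℓ₂ ℓ₃) (𝒱 : Set v) where
  open OrderedSemiring R hiding (zero)
  open SemiringSum semiring using (sum)
  open SetoidReasoning setoid

  -- The valuation `ρ` carries no proofs of nonnegativity, so single variables can later be
  -- overwritten freely. `eval p α` unfolds to `cp p ⊕ evalNcp (ncp p) ρ` for the values `ρ`
  -- underlying `α`.
  evalNcp : List (U × 𝒱) → (𝒱 → U) → U
  evalNcp ms ρ = List.foldr (λ (a , x) r → a ⊙ ρ x ⊕ r) 0# ms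

  evalNcp-++ : ∀ ms ns ρ → evalNcp (ms ++ ns) ρ ≈ evalNcp ms ρ ⊕ evalNcp ns ρ
  evalNcp-++ []             ns ρ = ≈-sym (+-identityˡ _)
  evalNcp-++ ((a , x) ∷ ms) ns ρ =
    ≈-trans (+-congˡ (evalNcp-++ ms ns ρ)) (≈-sym (+-assoc _ _ _))

  evalNcp-concat-tabulate : ∀ {n} (h : Vector (List (U × 𝒱)) n) ρ →
    evalNcp (List.concat (List.tabulate h)) ρ ≈ sum (λ i → evalNcp (h i) ρ)
  evalNcp-concat-tabulate {zero}  h ρ = ≈-refl
  evalNcp-concat-tabulate {suc n} h ρ =
    ≈-trans (evalNcp-++ (h zero) _ ρ) (+-congˡ (evalNcp-concat-tabulate (h ∘ suc) ρ))

  evalNcp-scale : ∀ b ms ρ →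
    evalNcp (List.map (λ (a , x) → b ⊙ a , x) ms) ρ ≈ b ⊙ evalNcp ms ρ
  evalNcp-scale b []             ρ = ≈-sym (zeroʳ b)
  evalNcp-scale b ((a , x) ∷ ms) ρ =
    ≈-trans (+-cong (*-assoc b a (ρ x)) (evalNcp-scale b ms ρ)) (≈-sym (distribˡ b _ _))

  evalNcp-zero : ∀ ms ρ → (∀ {x} → x ∈ List.map proj₂ ms → ρ x ≈ 0#) → evalNcp ms ρ ≈ 0#
  evalNcp-zero []             ρ ρ≈0 = ≈-refl
  evalNcp-zero ((a , x) ∷ ms) ρ ρ≈0 = begin
    a ⊙ ρ x ⊕ evalNcp ms ρ  ≈⟨ +-cong (*-congˡ (ρ≈0 (here refl))) (evalNcp-zero ms ρ (ρ≈0 ∘ there)) ⟩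
    a ⊙ 0# ⊕ 0#             ≈⟨ +-identityʳ _ ⟩
    a ⊙ 0#                  ≈⟨ zeroʳ a ⟩
    0#                      ∎

module PolynomialOrderProperties
  {c ℓ ℓ₁ ℓ₂ ℓ₃ f v} (R : OrderedSemiringWithMax c ℓ ℓ₁ ℓ₂ ℓ₃) (𝓕 : Signature f) (𝒱 : Set v)
  (Pol : LinearInterpretation R 𝓕) where

  open OrderedSemiringWithMax R
  open Signature 𝓕
  open LinearInterpretation Pol
  open PolynomialOrder R 𝓕 𝒱 Pol
  open OrderedSemiringProperties orderedSemiring
  open LinearForms orderedSemiring 𝒱
  open SemiringSum semiring using (sum; sum-cong-≋; ∑-distrib-+)

  -- Semantics of terms and the reduction pair.

  valuation : Assignment → 𝒱 → U
  valuation α x = proj₁ (α x)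

  ⟦_⟧≥0 : ∀ t α → ⟦ t ⟧ α ≥ 0#
  ⟦ var x    ⟧≥0 α = proj₂ (α x)
  ⟦ app g ts ⟧≥0 α = max₀≥0 _

  infixl 8 _·ᴬ_
  _·ᴬ_ : Substitution → Assignment → Assignment
  (σ ·ᴬ α) x = ⟦ σ x ⟧ α , ⟦ σ x ⟧≥0 α

  -- The substitution lemma: a substitution is absorbed into the assignment, so stability only
  -- instantiates the quantifier over assignments.
  ⟦·⟧ : ∀ t σ α → ⟦ t · σ ⟧ α ≈ ⟦ t ⟧ (σ ·ᴬ α)
  ⟦·⟧ (var x)    σ α = ≈-refl
  ⟦·⟧ (app g ts) σ α =
    max₀-cong (+-congˡ (sum-cong-≋ (λ i → *-congˡ (⟦·⟧ (ts i) σ α))))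

  ⟦app⟧-mono-≥ : ∀ g (ss ts : Vector Term (arity g)) α →
    (∀ i → ⟦ ss i ⟧ α ≥ ⟦ ts i ⟧ α) → ⟦ app g ss ⟧ α ≥ ⟦ app g ts ⟧ α
  ⟦app⟧-mono-≥ g ss ts α ss≥ts = max₀-mono (⊕-monoʳ-≥ (constant g)
    (sum-mono-≥ (λ i → ⊙-monoʳ-≥ (ss≥ts i) (coefficient≥0 g i))))

  -- At the hole the two vectors hold `s` and `t`; everywhere else they share an entry and
  -- reflexivity suffices.
  updateAt-mono-≿ : ∀ {n} (ts : Vector Term n) i s t → s ≿ t →
    ∀ j → updateAt ts i (const s) j ≿ updateAt ts i (const t) j
  updateAt-mono-≿ ts i s t s≿t j with j ≟ᶠ i
  ... | yes refl = subst₂ _≿_ (sym (updateAt-updates j ts)) (sym (updateAt-updates j ts)) s≿t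
  ... | no  j≢i  = subst₂ _≿_ (sym (updateAt-minimal j i ts j≢i)) (sym (updateAt-minimal j i ts j≢i))
                     (λ α → ≥-refl)

  ≿-monotone : Monotone _≿_
  ≿-monotone         □                 s≿t α = s≿t α
  ≿-monotone {s} {t} (inside g ts i C) s≿t α =
    ⟦app⟧-mono-≥ g (updateAt ts i (const (C ⟨ s ⟩))) (updateAt ts i (const (C ⟨ t ⟩))) α
      (λ j → updateAt-mono-≿ ts i (C ⟨ s ⟩) (C ⟨ t ⟩) (≿-monotone {s} {t} C s≿t) j α)

  ≿-stable : Stable _≿_
  ≿-stable {s} {t} σ s≿t α =
    ≥-trans (≥-reflexive (⟦·⟧ s σ α))
      (≥-trans (s≿t (σ ·ᴬ α)) (≥-reflexive (≈-sym (⟦·⟧ t σ α))))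

  ≻-stable : Stable _≻_
  ≻-stable {s} {t} σ s≻t α =
    ≥->-trans (≥-reflexive (⟦·⟧ s σ α))
      (>-≥-trans (s≻t (σ ·ᴬ α)) (≥-reflexive (≈-sym (⟦·⟧ t σ α))))

  ≻-terminating : Terminating _≻_
  ≻-terminating (ts , ts-desc) =
    -- The axiom asks for nonnegativity of the smaller side of each step, hence the index `suc n`.
    >-terminating ((λ n → ⟦ ts n ⟧ 𝟎) , λ n → ts-desc n 𝟎 , ⟦ ts (suc n) ⟧≥0 𝟎)
    where
    𝟎 : Assignment
    𝟎 x = 0# , ≥-refl

  isReductionPair : IsReductionPair _≿_ _≻_
  isReductionPair = record
    { ≿-trans       = λ s≿t t≿u α → ≥-trans (s≿t α) (t≿u α)
    ; ≻-trans       = λ s≻t t≻u α → >-trans (s≻t α) (t≻u α)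
    ; ≿-stable      = λ {s} {t} → ≿-stable {s} {t}
    ; ≻-stable      = λ {s} {t} → ≻-stable {s} {t}
    ; ≿-refl        = λ α → ≥-refl
    ; ≿-monotone    = λ {s} {t} → ≿-monotone {s} {t}
    ; ≻-terminating = ≻-terminating
    ; ≿-≻-trans     = λ s≿t t≻u α → ≥->-trans (s≿t α) (t≻u α)
    }

  -- Values of composed polynomials and the upper bound.

  evalNcp-substᴾ : ∀ g ps ρ →
    evalNcp (ncp (substᴾ g ps)) ρ ≈ sum (λ i → coefficient g i ⊙ evalNcp (ncp (ps i)) ρ)
  evalNcp-substᴾ g ps ρ = ≈-trans (evalNcp-concat-tabulate {n = arity g} _ ρ)
    (sum-cong-≋ (λ i → evalNcp-scale (coefficient g i) (ncp (ps i)) ρ))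

  -- The constant and non-constant parts are sums over the same arguments; they are merged argument
  -- by argument, and distributivity factors out each coefficient.
  eval-substᴾ : ∀ g ps α →
    eval (substᴾ g ps) α ≈ constant g ⊕ sum (λ i → coefficient g i ⊙ eval (ps i) α)
  eval-substᴾ g ps α = begin
    constant g ⊕ C ⊕ evalNcp (ncp (substᴾ g ps)) ρ     ≈⟨ +-assoc _ _ _ ⟩
    constant g ⊕ (C ⊕ evalNcp (ncp (substᴾ g ps)) ρ)   ≈⟨ +-congˡ (+-congˡ (evalNcp-substᴾ g ps ρ)) ⟩
    constant g ⊕ (C ⊕ N)                               ≈⟨ +-congˡ (∑-distrib-+ {arity g} _ _) ⟨
    constant g ⊕ sum (λ i → coefficient g i ⊙ cp (ps i) ⊕ coefficient g i ⊙ evalNcp (ncp (ps i)) ρ)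
      ≈⟨ +-congˡ (sum-cong-≋ (λ i → distribˡ (coefficient g i) _ _)) ⟨
    constant g ⊕ sum (λ i → coefficient g i ⊙ eval (ps i) α) ∎
    where
    open SetoidReasoning setoid
    ρ = valuation α
    C = sum (λ i → coefficient g i ⊙ cp (ps i))
    N = sum (λ i → coefficient g i ⊙ evalNcp (ncp (ps i)) ρ)

  eval-varᴾ : ∀ x α → eval (varᴾ x) α ≈ valuation α x
  eval-varᴾ x α = ≈-trans (+-identityˡ _) (≈-trans (+-identityʳ _) (*-identityˡ _))

  -- `max₀` alters only the constant part of `[ t ]right`, so the monomials are built from `1#` and
  -- the nonnegative coefficients alone.
  evalNcp-right≥0 : ∀ t α → evalNcp (ncp [ t ]right) (valuation α) ≥ 0#
  evalNcp-right≥0 (var x)    α = ⊕-nonneg (⊙-nonneg 1≥0 (proj₂ (α x))) ≥-refl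
  evalNcp-right≥0 (app g ts) α =
    ≥-trans (≥-reflexive (evalNcp-substᴾ g (λ i → [ ts i ]right) (valuation α)))
      (sum-nonneg (λ i → ⊙-nonneg (coefficient≥0 g i) (evalNcp-right≥0 (ts i) α)))

  -- `max₀ c ⊕ n` is a sum of nonnegative elements, hence fixed by `max₀`.
  max₀-⊕-≥ : ∀ c {n} → n ≥ 0# → max₀ c ⊕ n ≥ max₀ (c ⊕ n)
  max₀-⊕-≥ c {n} n≥0 =
    ≥-trans (≥-reflexive (≈-sym (max₀-id (⊕-nonneg (max₀≥0 c) n≥0))))
      (max₀-mono (⊕-monoˡ-≥ n (max₀≥ c)))

  eval-right≥⟦⟧ : ∀ t α → eval [ t ]right α ≥ ⟦ t ⟧ α
  eval-right≥⟦⟧ (var x)    α = ≥-reflexive (eval-varᴾ x α)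
  eval-right≥⟦⟧ (app g ts) α = begin
    max₀ (cp p) ⊕ evalNcp (ncp p) (valuation α)                           ∼⟨ max₀-⊕-≥ (cp p) (evalNcp-right≥0 (app g ts) α) ⟩
    max₀ (eval p α)                                                       ≈⟨ max₀-cong (eval-substᴾ g (λ i → [ ts i ]right) α) ⟩
    max₀ (constant g ⊕ sum (λ i → coefficient g i ⊙ eval [ ts i ]right α)) ∼⟨ max₀-mono (⊕-monoʳ-≥ (constant g)
      (sum-mono-≥ (λ i → ⊙-monoʳ-≥ (eval-right≥⟦⟧ (ts i) α) (coefficient≥0 g i)))) ⟩
    ⟦ app g ts ⟧ α                                                        ∎
    where
    open PreorderReasoning ≥-preorder
    p = substᴾ g (λ i → [ ts i ]right)

  -- Formally zero linear forms and the lower bound.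

  module LeftProperties (_≟_ : DecidableEquality 𝒱) (_≈0? : ∀ u → Dec (u ≈ 0#)) where
    open Left _≟_ _≈0?

    erase : 𝒱 → (𝒱 → U) → 𝒱 → U
    erase y ρ x = if does (x ≟ y) then 0# else ρ x

    -- The monomials in `y` may be scattered over the list. Erasing `y` collects their contributions
    -- into one product with the total coefficient and leaves the other monomials in place.
    evalNcp-erase : ∀ ms y ρ →
      evalNcp ms ρ ≈ coeffOf ms y ⊙ ρ y ⊕ evalNcp ms (erase y ρ)
    evalNcp-erase []             y ρ = ≈-sym (≈-trans (+-identityʳ _) (zeroˡ _))
    evalNcp-erase ((a , x) ∷ ms) y ρ with x ≟ y
    ... | yes refl = begin
      a ⊙ ρ x ⊕ evalNcp ms ρ                     ≈⟨ +-congˡ (evalNcp-erase ms x ρ) ⟩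
      a ⊙ ρ x ⊕ (b ⊙ ρ x ⊕ r)                    ≈⟨ +-assoc _ _ _ ⟨
      a ⊙ ρ x ⊕ b ⊙ ρ x ⊕ r                      ≈⟨ +-cong (distribʳ (ρ x) a b) (+-identityˡ r) ⟨
      -- The erased valuation sends `x` to `0#`, so the head monomial remains as `a ⊙ 0#`.
      (a ⊕ b) ⊙ ρ x ⊕ (0# ⊕ r)                   ≈⟨ +-congˡ (+-congʳ (zeroʳ a)) ⟨
      (a ⊕ b) ⊙ ρ x ⊕ (a ⊙ 0# ⊕ r)               ∎
      where
      open SetoidReasoning setoid
      b = coeffOf ms x
      r = evalNcp ms (erase x ρ)
    ... | no _ = begin
      a ⊙ ρ x ⊕ evalNcp ms ρ                     ≈⟨ +-congˡ (evalNcp-erase ms y ρ) ⟩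
      a ⊙ ρ x ⊕ (b ⊙ ρ y ⊕ r)                    ≈⟨ +-assoc _ _ _ ⟨
      a ⊙ ρ x ⊕ b ⊙ ρ y ⊕ r                      ≈⟨ +-congʳ (+-comm _ _) ⟩
      b ⊙ ρ y ⊕ a ⊙ ρ x ⊕ r                      ≈⟨ +-assoc _ _ _ ⟩
      b ⊙ ρ y ⊕ (a ⊙ ρ x ⊕ r)                    ∎
      where
      open SetoidReasoning setoid
      b = coeffOf ms y
      r = evalNcp ms (erase y ρ)

    eraseAll : List 𝒱 → (𝒱 → U) → 𝒱 → U
    eraseAll ys ρ = List.foldr erase ρ ys

    eraseAll-∈ : ∀ {ys x} ρ → x ∈ ys → eraseAll ys ρ x ≈ 0#
    eraseAll-∈ {y ∷ ys} {x} ρ x∈ with x ≟ y | x∈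
    ... | yes _   | _          = ≈-refl
    ... | no  x≢y | here x≡y   = ⊥-elim (x≢y x≡y)
    ... | no  _   | there x∈ys = eraseAll-∈ ρ x∈ys

    -- Each erasure removes a term whose coefficient is zero. The list `ys` is independent of `ms`,
    -- so that the induction on it keeps the form fixed.
    evalNcp-eraseAll : ∀ ms ρ → (∀ x → coeffOf ms x ≈ 0#) →
      ∀ ys → evalNcp ms ρ ≈ evalNcp ms (eraseAll ys ρ)
    evalNcp-eraseAll ms ρ coeff≈0 []       = ≈-refl
    evalNcp-eraseAll ms ρ coeff≈0 (y ∷ ys) = begin
      evalNcp ms ρ                         ≈⟨ evalNcp-eraseAll ms ρ coeff≈0 ys ⟩
      evalNcp ms ρ′                        ≈⟨ evalNcp-erase ms y ρ′ ⟩
      coeffOf ms y ⊙ ρ′ y ⊕ r              ≈⟨ +-congʳ (*-congʳ (coeff≈0 y)) ⟩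
      0# ⊙ ρ′ y ⊕ r                        ≈⟨ +-congʳ (zeroˡ _) ⟩
      0# ⊕ r                               ≈⟨ +-identityˡ r ⟩
      r                                    ∎
      where
      open SetoidReasoning setoid
      ρ′ = eraseAll ys ρ
      r  = evalNcp ms (erase y ρ′)

    -- Vanishing coefficients do not make the list empty: monomials of one variable may cancel. Once
    -- every occurring variable is erased, each monomial vanishes separately.
    NcpZero⇒evalNcp≈0 : ∀ p ρ → NcpZero p → evalNcp (ncp p) ρ ≈ 0#
    NcpZero⇒evalNcp≈0 p ρ ncp≈0 =
      ≈-trans (evalNcp-eraseAll (ncp p) ρ ncp≈0 (List.map proj₂ (ncp p)))
        (evalNcp-zero (ncp p) _ (eraseAll-∈ ρ))

    -- Taking the decision `z?` as an argument lets a match on it reduce the conditional in the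
    -- definition of `[_]left`.
    max₀-≥-eval : ∀ {u} p α (z? : Dec (NcpZero p)) → u ≥ eval p α →
      max₀ u ≥ eval (if does z? then max₀ (cp p) ⊞ [] else p) α
    max₀-≥-eval     p α (no  _)     u≥p = ≥-trans (max₀≥ _) u≥p
    max₀-≥-eval {u} p α (yes ncp≈0) u≥p = begin
      max₀ u                                       ∼⟨ max₀-mono u≥p ⟩
      max₀ (cp p ⊕ evalNcp (ncp p) (valuation α))  ≈⟨ max₀-cong (+-congˡ (NcpZero⇒evalNcp≈0 p _ ncp≈0)) ⟩
      max₀ (cp p ⊕ 0#)                             ≈⟨ max₀-cong (+-identityʳ _) ⟩
      -- The trailing `0#` is the value of the empty list of monomials.
      max₀ (cp p)                                  ≈⟨ +-identityʳ _ ⟨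
      max₀ (cp p) ⊕ 0#                             ∎
      where open PreorderReasoning ≥-preorder

    ⟦⟧≥eval-left : ∀ t α → ⟦ t ⟧ α ≥ eval [ t ]left α
    ⟦⟧≥eval-left (var x)    α = ≥-reflexive (≈-sym (eval-varᴾ x α))
    ⟦⟧≥eval-left (app g ts) α = max₀-≥-eval p α (ncpZero? p)
      (≥-trans (⊕-monoʳ-≥ (constant g)
                 (sum-mono-≥ (λ i → ⊙-monoʳ-≥ (⟦⟧≥eval-left (ts i) α) (coefficient≥0 g i))))
               (≥-reflexive (≈-sym (eval-substᴾ g (λ i → [ ts i ]left) α))))
      where p = substᴾ g (λ i → [ ts i ]left)

    >ᴾ⇒≻ : ∀ s t → [ s ]left >ᴾ [ t ]right → s ≻ t
    >ᴾ⇒≻ s t s>t α = ≥->-trans (⟦⟧≥eval-left s α) (>-≥-trans (s>t α) (eval-right≥⟦⟧ t α))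

    ≥ᴾ⇒≿ : ∀ s t → [ s ]left ≥ᴾ [ t ]right → s ≿ t
    ≥ᴾ⇒≿ s t s≥t α = ≥-trans (⟦⟧≥eval-left s α) (≥-trans (s≥t α) (eval-right≥⟦⟧ t α))

theorem7 : ∀ {c ℓ ℓ₁ ℓ₂ ℓ₃ f v} (R : OrderedSemiringWithMax c ℓ ℓ₁ ℓ₂ ℓ₃)
    (𝓕 : Signature f) (𝒱 : Set v) (Pol : LinearInterpretation R 𝓕) →
    let open OrderedSemiringWithMax R
        open PolynomialOrder R 𝓕 𝒱 Pol in
    IsReductionPair _≿_ _≻_ ×
    ((_≟_ : DecidableEquality 𝒱) (_≈0? : ∀ u → Dec (u ≈ 0#)) →
      let open Left _≟_ _≈0? in
      (∀ s t → [ s ]left >ᴾ [ t ]right → s ≻ t) ×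
      (∀ s t → [ s ]left ≥ᴾ [ t ]right → s ≿ t))
theorem7 R 𝓕 𝒱 Pol = isReductionPair , λ _≟_ _≈0? →
  let open LeftProperties _≟_ _≈0? in >ᴾ⇒≻ , ≥ᴾ⇒≿
  where open PolynomialOrderProperties R 𝓕 𝒱 Pol
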